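{- For all integers $n\ge 0$, $$F_{2n+2}^2=F_1^2+\sum_{k=1}^n\left\{F_{2k+1}^2+2\sum_{i=1}^{2k}F_i^2\right\}.$$
   Context: The Fibonacci numbers are $F_0=0$, $F_1=1$, $F_n=F_{n-1}+F_{n-2}$ for $n\ge2$. Empty sums are $0$. -}

module Defs where

open import Data.Nat using (ℕ; zero; suc; _+_)

F : ℕ → ℕ
F 0             = 0
F 1             = 1
F (suc (suc n)) = F (suc n) + F n

-- f 1 + f 2 + ⋯ + f n; the index starts at 1, and f 0 is never used.
∑₁ : ℕ → (ℕ → ℕ) → ℕ
∑₁ zero    f = 0
∑₁ (suc n) f = ∑₁ n f + f (suc n)

infix 5 ∑₁
syntax ∑₁ n (λ k → e) = ∑[ 1≤ k ≤ n ] e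

{-# OPTIONS --safe #-}
-- With F₁² + ⋯ + F_m² = F_m F_{m+1}, squaring F_{m+2} = F_{m+1} + F_m gives
-- F_{m+2}² = F_m² + (F_{m+1}² + 2 (F₁² + ⋯ + F_m²)), which telescopes over
-- even m.
module Submission where

open import Defs
open import Data.Nat using (ℕ; zero; suc; _+_; _*_; _^_)
open import Data.Nat.Properties using (+-assoc; +-comm; *-suc)
open import Data.Nat.Tactic.RingSolver using (solve-∀)
open import Relation.Binary.PropositionalEquality
  using (_≡_; refl; trans; cong; module ≡-Reasoning)

open ≡-Reasoning

-- The cross term in the square of `F (m + 1) + F m` is twice the sum of the first `m` squares. So
-- the `k`-th summand is the gap between the squares of F_{2k} and F_{2k+2}, and the sum telescopes
-- down to F_2 = F_1.

-- A square of side `F (suc m)` glued to an `F m` by `F (suc m)` rectangle extends it to the next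
-- one.
∑F²≡F*F : ∀ m → (∑[ 1≤ i ≤ m ] (F i ^ 2)) ≡ F m * F (suc m)
∑F²≡F*F zero    = refl
∑F²≡F*F (suc m) = begin
  (∑[ 1≤ i ≤ m ] (F i ^ 2)) + F (suc m) ^ 2 ≡⟨ cong (_+ F (suc m) ^ 2) (∑F²≡F*F m) ⟩
  F m * F (suc m) + F (suc m) ^ 2           ≡⟨ factor (F m) (F (suc m)) ⟩
  F (suc m) * F (suc (suc m))               ∎
  where
  factor : ∀ a b → a * b + b * (b * 1) ≡ b * (b + a)
  factor = solve-∀

F²-step : ∀ m →
  F (m + 2) ^ 2 ≡ F m ^ 2 + (F (m + 1) ^ 2 + 2 * (∑[ 1≤ i ≤ m ] (F i ^ 2)))
-- Turning `m + 2` into `2 + m` lets `F` unfold by its recurrence.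
F²-step m rewrite +-comm m 2 | +-comm m 1 | ∑F²≡F*F m = square (F m) (F (suc m))
  where
  square : ∀ a b →
    (b + a) * ((b + a) * 1) ≡ a * (a * 1) + (b * (b * 1) + 2 * (a * b))
  square = solve-∀

mainTheorem4 : ∀ (n : ℕ) →
    F (2 * n + 2) ^ 2 ≡
    F 1 ^ 2 + (∑[ 1≤ k ≤ n ] (F (2 * k + 1) ^ 2 + 2 * (∑[ 1≤ i ≤ 2 * k ] (F i ^ 2))))
-- The telescope bottoms out at `F 2`, which equals `F 1`.
mainTheorem4 zero    = refl
mainTheorem4 (suc n) = begin
  F (2 * suc n + 2) ^ 2               ≡⟨ F²-step (2 * suc n) ⟩
  F (2 * suc n) ^ 2 + term (suc n)    ≡⟨ cong (λ j → F j ^ 2 + term (suc n)) 2*suc ⟩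
  F (2 * n + 2) ^ 2 + term (suc n)    ≡⟨ cong (_+ term (suc n)) (mainTheorem4 n) ⟩
  F 1 ^ 2 + ∑₁ n term + term (suc n)  ≡⟨ +-assoc (F 1 ^ 2) (∑₁ n term) (term (suc n)) ⟩
  F 1 ^ 2 + ∑₁ (suc n) term           ∎
  where
  term : ℕ → ℕ
  term k = F (2 * k + 1) ^ 2 + 2 * (∑[ 1≤ i ≤ 2 * k ] (F i ^ 2))

  2*suc : 2 * suc n ≡ 2 * n + 2
  2*suc = trans (*-suc 2 n) (+-comm 2 (2 * n))
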